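{- Let $\lambda,\kappa,\lambda',\kappa'$ be regular infinite cardinals with $\lambda>\kappa$ and $\lambda'>\kappa'$. The following are equivalent. (1) $\lambda\le\lambda'$ and $\kappa\le\kappa'$. (2) Every partial order with the $(\lambda,\kappa)$-FN has the $(\lambda',\kappa')$-FN. (3) Every boolean algebra with the $(\lambda,\kappa)$-FN has the $(\lambda',\kappa')$-FN.
   Context: For infinite cardinals $\lambda\ge\kappa$, a partial order $P$ has the $(\lambda,\kappa)$-FN (the $(\lambda,\kappa)$-Freese-Nation property) iff there is a map $(f,g)\colon P\to[P]^{<\lambda}\times[P]^{<\kappa}$ such that for all $p\le q$ in $P$ there exist $r\in f(p)\cap g(q)$ with $p\le r\le q$ and $s\in g(p)\cap f(q)$ with $p\le s\le q$. Here $[P]^{<\mu}$ is the set of subsets of $P$ of cardinality less than $\mu$. A boolean algebra has the $(\lambda,\kappa)$-FN iff its underlying partial order does. -}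

module Defs where

open import Algebra.Lattice.Bundles using (BooleanAlgebra)
import Algebra.Lattice.Properties.BooleanAlgebra as BooleanAlgebraProperties
open import Data.Nat.Base using (ℕ)
open import Data.Product.Base using (∃-syntax; _×_; proj₁)
open import Data.Sum.Base using (_⊎_)
open import Function.Bundles using (Func; Injection)
open import Induction.WellFounded using (WellFounded)
open import Level using (Level; suc; _⊔_)
open import Relation.Binary.Bundles using (Poset; Setoid)
open import Relation.Binary.Core using (Rel)
open import Relation.Binary.Definitions using (_Respects_)
open import Relation.Binary.PropositionalEquality using (_≡_; setoid)
open import Relation.Binary.Structures using (IsStrictTotalOrder)
import Relation.Binary.Construct.On as On
open import Relation.Nullary.Negation using (¬_)
open import Relation.Unary using (Pred; _∈_; _∩_; _≐_)
open import Relation.Unary.Relation.Binary.Equality using (≐-setoid)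

private
  variable
    a b ℓ : Level

-- Sets are setoids, so cardinalities are compared by injections that respect,
-- and reflect, the setoid equalities.

infix 4 _≼_ _≺_

_≼_ : Setoid a a → Setoid b b → Set (a ⊔ b)
A ≼ B = Injection A B

_≺_ : Setoid a a → Setoid b b → Set (a ⊔ b)
A ≺ B = A ≼ B × ¬ (B ≼ A)

-- Elements of a subset are identified when their underlying elements are
-- equal, whatever their membership proofs.

subsetoid : (A : Setoid ℓ ℓ) → Pred (Setoid.Carrier A) ℓ → Setoid ℓ ℓ
subsetoid A S = On.setoid A (proj₁ {B = S})

-- Cardinals are initial ordinals: well-orders that do not inject into any of
-- their proper initial segments.

record Cardinal ℓ : Set (suc ℓ) where
  infix 4 _<_
  field
    Carrier            : Set ℓ
    _<_                : Rel Carrier ℓ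
    isStrictTotalOrder : IsStrictTotalOrder _≡_ _<_
    wellFounded        : WellFounded _<_
    initial            : ∀ x → ¬ (setoid Carrier ≼
                                  subsetoid (setoid Carrier) (_< x))

∣_∣ : Cardinal ℓ → Setoid ℓ ℓ
∣ κ ∣ = setoid (Cardinal.Carrier κ)

infix 4 _≤ᶜ_ _<ᶜ_

_≤ᶜ_ : Rel (Cardinal ℓ) ℓ
κ ≤ᶜ μ = ∣ κ ∣ ≼ ∣ μ ∣

_<ᶜ_ : Rel (Cardinal ℓ) ℓ
κ <ᶜ μ = ∣ κ ∣ ≺ ∣ μ ∣

Infinite : Cardinal ℓ → Set ℓ
Infinite κ = setoid ℕ ≼ ∣ κ ∣

Cofinal : (κ : Cardinal ℓ) → Pred (Cardinal.Carrier κ) ℓ → Set ℓ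
Cofinal κ S = ∀ x → ∃[ y ] y ∈ S × (x < y ⊎ x ≡ y)
  where open Cardinal κ

-- cf(κ) = κ: no cofinal subset of κ has cardinality less than κ.

Regular : Cardinal ℓ → Set (suc ℓ)
Regular κ = ∀ S → Cofinal κ S → ∣ κ ∣ ≼ subsetoid ∣ κ ∣ S

record IsRegularInfinite (κ : Cardinal ℓ) : Set (suc ℓ) where
  field
    infinite : Infinite κ
    regular  : Regular κ

record SmallSubset (A : Setoid ℓ ℓ) (κ : Cardinal ℓ) : Set (suc ℓ) where
  open Setoid A using (Carrier; _≈_)
  field
    elements : Pred Carrier ℓ
    resp     : elements Respects _≈_
    small    : subsetoid A elements ≺ ∣ κ ∣

-- [A]^{<κ}, with extensional equality of subsets.

[_]^<_ : Setoid ℓ ℓ → Cardinal ℓ → Setoid (suc ℓ) ℓ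
[_]^<_ {ℓ} A κ = On.setoid (≐-setoid (Setoid.Carrier A) ℓ)
                           (SmallSubset.elements {A = A} {κ = κ})

-- The (μ,κ)-Freese–Nation property, meant for infinite μ ≥ κ. The map into
-- [P]^{<μ} × [P]^{<κ} is given by its two components.

record FN (μ κ : Cardinal ℓ) (P : Poset ℓ ℓ ℓ) : Set (suc ℓ) where
  open Poset P using (Carrier; _≤_; module Eq)
  field
    f : Func Eq.setoid ([ Eq.setoid ]^< μ)
    g : Func Eq.setoid ([ Eq.setoid ]^< κ)

  F : Carrier → Pred Carrier ℓ
  F p = SmallSubset.elements (Func.to f p)

  G : Carrier → Pred Carrier ℓ
  G p = SmallSubset.elements (Func.to g p)

  field
    interpolate-fg : ∀ {p q} → p ≤ q → ∃[ r ] r ∈ F p ∩ G q × p ≤ r × r ≤ q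
    interpolate-gf : ∀ {p q} → p ≤ q → ∃[ s ] s ∈ G p ∩ F q × p ≤ s × s ≤ q

-- The order of a Boolean algebra is x ≤ y iff x ≈ x ∧ y.

FNᴮ : Cardinal ℓ → Cardinal ℓ → BooleanAlgebra ℓ ℓ → Set (suc ℓ)
FNᴮ μ κ B = FN μ κ (BooleanAlgebraProperties.poset B)

{-# OPTIONS --safe #-}

-- That (3) implies (1) is witnessed by a single Boolean algebra. Let A be freely
-- generated by elements a i (i < κ′) and b j (j < μ′) subject to a i ≤ b j. Its
-- Stone space consists of 2^κ′ and 2^μ′ glued at the point where every a i is
-- false and every b j is true. An element r that holds at this point is below
-- only finitely many b j, and any other r is above only finitely many a i; by
-- regularity of μ′ > κ′ this excludes the (μ′,κ′)-FN. If μ′ < μ then |A| < μ, and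
-- all posets of size less than μ have the (μ,κ)-FN. If κ′ < κ then A has the
-- (κ,κ)-FN: send p to the elements whose restriction to 2^μ′ depends only on
-- generators b j on which p depends, and interpolate as in Craig's theorem.

module Submission where

open import Defs
open import Algebra.Lattice.Bundles using (BooleanAlgebra)
open import Axiom.ExcludedMiddle using (ExcludedMiddle)
open import Data.Product.Base using (_×_)
open import Function.Bundles using (_⇔_)
open import Level using (Level)
open import Relation.Binary.Bundles using (Poset)

import Algebra.Lattice.Properties.BooleanAlgebra as BooleanAlgebraProperties
open import Data.Bool.Base using (Bool; true; false; _∧_; _∨_; not; if_then_else_)
import Data.Bool.Properties as Bool
open import Data.List.Base using (List; []; _∷_; _++_; length)
open import Data.List.Membership.Propositional using () renaming (_∈_ to _∈ˡ_)
open import Data.List.Membership.Propositional.Properties using (∈-++⁺ˡ; ∈-++⁺ʳ)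
open import Data.List.Relation.Unary.Any using (here; there)
open import Data.Nat.Base using (ℕ; zero; suc)
import Data.Nat.Properties as ℕ
open import Data.Product.Base using (∃; ∃-syntax; _,_; proj₁; proj₂)
open import Data.Product.Relation.Binary.Lex.Strict
  using (×-Lex; ×-isStrictTotalOrder; ×-wellFounded)
open import Data.Product.Relation.Binary.Pointwise.NonDependent using (_×ₛ_)
open import Data.Sum.Base using (_⊎_; inj₁; inj₂)
open import Data.Unit.Base using (⊤)
import Function.Construct.Composition as Composition
import Function.Construct.Identity as Identity
open import Function.Base using (_∘_; id; case_of_)
open import Function.Bundles using (Func; Injection; mk⇔)
open import Induction.WellFounded using (WellFounded; Acc; acc)
open import Level using (Lift; _⊔_)
open import Relation.Binary.Bundles using (Setoid)
open import Relation.Binary.Core using (Rel)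
import Relation.Binary.Construct.On as On
open import Relation.Binary.Definitions using (tri<; tri≈; tri>; _Respects_)
open import Relation.Binary.PropositionalEquality
  using (_≡_; _≢_; refl; sym; trans; cong; cong₂; subst; setoid; _≗_; _→-setoid_)
open import Relation.Binary.Structures using (IsStrictTotalOrder)
open import Relation.Nullary.Decidable using (yes; no; ⌊_⌋; decidable-stable)
open import Relation.Nullary.Negation using (¬_; contradiction)
open import Relation.Unary using (Pred; _∈_; _⊆_; _≐_; _∩_; _∪_)

private
  variable
    a b c p q ℓ : Level

-- Comparison of sizes and monotonicity of the FN property

≼-trans : {A : Setoid a a} {B : Setoid b b} {C : Setoid c c} →
          A ≼ B → B ≼ C → A ≼ C
≼-trans = Composition.injection

≼-≺-trans : {A : Setoid a a} {B : Setoid b b} {C : Setoid c c} →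
            A ≼ B → B ≺ C → A ≺ C
≼-≺-trans A≼B (B≼C , C⋠B) = ≼-trans A≼B B≼C , λ C≼A → C⋠B (≼-trans C≼A A≼B)

≺-≼-trans : {A : Setoid a a} {B : Setoid b b} {C : Setoid c c} →
            A ≺ B → B ≼ C → A ≺ C
≺-≼-trans (A≼B , B⋠A) B≼C = ≼-trans A≼B B≼C , λ C≼A → B⋠A (≼-trans B≼C C≼A)

subsetoid-mono : {A : Setoid ℓ ℓ} {S T : Pred (Setoid.Carrier A) ℓ} →
                 S ⊆ T → subsetoid A S ≼ subsetoid A T
subsetoid-mono S⊆T = record
  { to = λ (x , x∈S) → x , S⊆T x∈S ; cong = id ; injective = id }

widen : {A : Setoid ℓ ℓ} {κ κ′ : Cardinal ℓ} → κ ≤ᶜ κ′ → SmallSubset A κ → SmallSubset A κ′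
widen κ≤κ′ S = record { elements = elements ; resp = resp ; small = ≺-≼-trans small κ≤κ′ }
  where open SmallSubset S

FN-mono : {μ κ μ′ κ′ : Cardinal ℓ} → μ ≤ᶜ μ′ → κ ≤ᶜ κ′ →
          (P : Poset ℓ ℓ ℓ) → FN μ κ P → FN μ′ κ′ P
FN-mono μ≤μ′ κ≤κ′ P fn = record
  { f = record { to = widen μ≤μ′ ∘ Func.to f ; cong = Func.cong f }
  ; g = record { to = widen κ≤κ′ ∘ Func.to g ; cong = Func.cong g }
  ; interpolate-fg = interpolate-fg
  ; interpolate-gf = interpolate-gf
  }
  where open FN fn

-- Boolean algebras of functions

functionAlgebra : {X : Set ℓ} (M : Pred (X → Bool) ℓ) → (∀ b → (λ _ → b) ∈ M) →
                  (∀ (_∙_ : Bool → Bool → Bool) {f g} → f ∈ M → g ∈ M → (λ x → f x ∙ g x) ∈ M) →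
                  BooleanAlgebra ℓ ℓ
functionAlgebra M M-const M-zip = record
  { Carrier = ∃ M
  ; _≈_     = λ (f , _) (g , _) → f ≗ g
  ; _∨_     = λ (f , f∈M) (g , g∈M) → _ , M-zip _∨_ f∈M g∈M
  ; _∧_     = λ (f , f∈M) (g , g∈M) → _ , M-zip _∧_ f∈M g∈M
  -- Complement is treated as a binary operation that ignores its second argument, so `M-zip` covers
  -- it.
  ; ¬_      = λ (f , f∈M) → _ , M-zip (λ b _ → not b) f∈M f∈M
  ; ⊤       = _ , M-const true
  ; ⊥       = _ , M-const false
  ; isBooleanAlgebra = record
    { isDistributiveLattice = record
      { isLattice = record
        { isEquivalence = record
          { refl  = λ x → refl
          ; sym   = λ f≗g x → sym (f≗g x)
          ; trans = λ f≗g g≗h x → trans (f≗g x) (g≗h x)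
          }
        ; ∨-comm     = λ (f , _) (g , _) x → Bool.∨-comm (f x) (g x)
        ; ∨-assoc    = λ (f , _) (g , _) (h , _) x → Bool.∨-assoc (f x) (g x) (h x)
        ; ∨-cong     = λ f≗g h≗k x → cong₂ _∨_ (f≗g x) (h≗k x)
        ; ∧-comm     = λ (f , _) (g , _) x → Bool.∧-comm (f x) (g x)
        ; ∧-assoc    = λ (f , _) (g , _) (h , _) x → Bool.∧-assoc (f x) (g x) (h x)
        ; ∧-cong     = λ f≗g h≗k x → cong₂ _∧_ (f≗g x) (h≗k x)
        ; absorptive = (λ (f , _) (g , _) x → Bool.∨-abs-∧ (f x) (g x))
                     , (λ (f , _) (g , _) x → Bool.∧-abs-∨ (f x) (g x))
        }
      ; ∨-distrib-∧ = (λ (f , _) (g , _) (h , _) x → Bool.∨-distribˡ-∧ (f x) (g x) (h x))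
                    , (λ (f , _) (g , _) (h , _) x → Bool.∨-distribʳ-∧ (f x) (g x) (h x))
      ; ∧-distrib-∨ = (λ (f , _) (g , _) (h , _) x → Bool.∧-distribˡ-∨ (f x) (g x) (h x))
                    , (λ (f , _) (g , _) (h , _) x → Bool.∧-distribʳ-∨ (f x) (g x) (h x))
      }
    ; ∨-complement = (λ (f , _) x → Bool.∨-inverseˡ (f x)) , (λ (f , _) x → Bool.∨-inverseʳ (f x))
    ; ∧-complement = (λ (f , _) x → Bool.∧-inverseˡ (f x)) , (λ (f , _) x → Bool.∧-inverseʳ (f x))
    ; ¬-cong       = λ f≗g x → cong not (f≗g x)
    }
  }

-- Choice and least elements from excluded middle

module Classical (em : ∀ {a} → ExcludedMiddle a) where

  byContradiction : {A : Set a} → ¬ ¬ A → A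
  byContradiction = decidable-stable em

  -- A weakly constant endomap: choices made through it do not depend on the
  -- proof that a choice exists.

  canonical : {A : Set a} → A → A
  canonical {A = A} x with em {P = A}
  ... | yes y = y
  ... | no ¬A = contradiction x ¬A

  canonical-const : {A : Set a} (x y : A) → canonical x ≡ canonical y
  canonical-const {A = A} x y with em {P = A}
  ... | yes _ = refl
  ... | no ¬A = contradiction x ¬A

  -- Disjointness makes any choice of indices injective; choosing through `canonical` makes it
  -- independent of the proof of `x ∈ S`.
  choose-≼ : {A : Set a} (I : Setoid ℓ ℓ) (S : Pred A a) (R : A → Pred (Setoid.Carrier I) ℓ) →
             (∀ {x} → x ∈ S → ∃ (R x)) →
             (∀ {x y i j} → i ∈ R x → j ∈ R y → Setoid._≈_ I i j → x ≡ y) →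
             subsetoid (setoid A) S ≼ I
  choose-≼ I S R nonempty disjoint = record
    { to        = λ (x , x∈S) → proj₁ (canonical (nonempty x∈S))
    ; cong      = λ { {x , x∈S} {_ , y∈S} refl → Setoid.reflexive I
                      (cong proj₁ (canonical-const (nonempty x∈S) (nonempty y∈S))) }
    ; injective = λ {(x , x∈S)} {(y , y∈S)} → disjoint
                    (proj₂ (canonical (nonempty x∈S))) (proj₂ (canonical (nonempty y∈S)))
    }

  module Minimum {A : Set a} {_<_ : Rel A b} (sto : IsStrictTotalOrder _≡_ _<_)
                 (wf : WellFounded _<_) where

    open IsStrictTotalOrder sto using (compare)

    Minimal : Pred A p → Pred A (a ⊔ b ⊔ p)
    Minimal P x = x ∈ P × (∀ {y} → y ∈ P → ¬ (y < x))

    minimal-exists : {P : Pred A p} → ∃ P → ∃ (Minimal P)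
    minimal-exists {P = P} (x , x∈P) = go x (wf x) x∈P
      where
      go : ∀ x → Acc _<_ x → x ∈ P → ∃ (Minimal P)
      go x (acc rs) x∈P with em {P = ∃[ y ] y ∈ P × (y < x)}
      ... | yes (y , y∈P , y<x) = go y (rs y<x) y∈P
      ... | no ∄y = x , x∈P , λ y∈P y<x → ∄y (_ , y∈P , y<x)

    minimal-unique : {P : Pred A p} {Q : Pred A q} → P ≐ Q →
                     ∀ {x y} → x ∈ Minimal P → y ∈ Minimal Q → x ≡ y
    minimal-unique (P⊆Q , Q⊆P) {x} {y} (x∈P , x-min) (y∈Q , y-min) with compare x y
    ... | tri< x<y _ _ = contradiction x<y (y-min (P⊆Q x∈P))
    ... | tri≈ _ x≡y _ = x≡y
    ... | tri> _ _ y<x = contradiction y<x (x-min (Q⊆P y∈Q))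

  -- Regular cardinals

  module RegularCardinal {ℓ} (κ : Cardinal ℓ) (κ-regular : IsRegularInfinite κ) where

    open Cardinal κ
    open IsStrictTotalOrder isStrictTotalOrder using (compare) renaming (trans to <-trans)
    open IsRegularInfinite κ-regular
    open Minimum isStrictTotalOrder wellFounded

    <-irrefl : ∀ {x} → ¬ (x < x)
    <-irrefl = IsStrictTotalOrder.irrefl isStrictTotalOrder refl

    element : ℕ → Carrier
    element = Injection.to infinite

    element-injective : ∀ {m n} → element m ≡ element n → m ≡ n
    element-injective = Injection.injective infinite

    Bounded : Pred Carrier ℓ → Set ℓ
    Bounded T = ∃[ β ] (∀ {x} → x ∈ T → x < β)

    bounded-mono : ∀ {S T} → S ⊆ T → Bounded T → Bounded S
    bounded-mono S⊆T (β , T<β) = β , λ x∈S → T<β (S⊆T x∈S)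

    -- An unbounded `T` is cofinal: a point that is not a strict bound has an element of `T` at or
    -- above it. Regularity then injects κ into `T`.
    small⇒bounded : ∀ {T} → ¬ (∣ κ ∣ ≼ subsetoid ∣ κ ∣ T) → Bounded T
    small⇒bounded {T} κ⋠T = byContradiction λ unbounded → κ⋠T (regular T λ x →
      byContradiction λ ∄y → unbounded (x , λ {y} y∈T → below (λ r → ∄y (y , y∈T , r))))
      where
      below : ∀ {x y} → ¬ (x < y ⊎ x ≡ y) → y < x
      below {x} {y} x≰y with compare x y
      ... | tri< x<y _ _ = contradiction (inj₁ x<y) x≰y
      ... | tri≈ _ x≡y _ = contradiction (inj₂ x≡y) x≰y
      ... | tri> _ _ y<x = y<x

    -- Each `T i` is replaced by its least strict upper bound. These bounds inject into `I`, so they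
    -- are too few to be unbounded, and a bound on them exceeds every `T i`.
    ⋃-bounded : (I : Setoid ℓ ℓ) → ¬ (∣ κ ∣ ≼ I) →
                (T : Setoid.Carrier I → Pred Carrier ℓ) →
                (∀ {i j} → Setoid._≈_ I i j → T i ⊆ T j) →
                (∀ i → Bounded (T i)) → Bounded (λ x → ∃[ i ] x ∈ T i)
    ⋃-bounded I κ⋠I T T-resp T-bounded =
      let β , sups<β = small⇒bounded λ κ≼Sup → κ⋠I (≼-trans κ≼Sup Sup≼I)
      in β , λ (i , x∈Ti) →
           let σ , σ-sup = minimal-exists (T-bounded i)
           in <-trans (proj₁ σ-sup x∈Ti) (sups<β (i , σ-sup))
      where
      open Setoid I using () renaming (sym to ≈-sym)

      UpperBound : Setoid.Carrier I → Pred Carrier ℓ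
      UpperBound i β = ∀ {x} → x ∈ T i → x < β

      Sup≼I : subsetoid ∣ κ ∣ (λ σ → ∃[ i ] σ ∈ Minimal (UpperBound i)) ≼ I
      Sup≼I = choose-≼ I _ (λ σ i → σ ∈ Minimal (UpperBound i)) id
        (λ {_} {_} {i} {j} σ-sup τ-sup i≈j →
          minimal-unique {P = UpperBound i} {Q = UpperBound j}
            ((λ <β y∈Tj → <β (T-resp (≈-sym i≈j) y∈Tj)) , (λ <β x∈Ti → <β (T-resp i≈j x∈Ti)))
            σ-sup τ-sup)

    ∪-bounded : ∀ {S T} → Bounded S → Bounded T → Bounded (S ∪ T)
    ∪-bounded {S} {T} (β , S<β) (γ , T<γ) with compare β γ
    ... | tri< β<γ _ _ = γ , λ { (inj₁ x∈S) → <-trans (S<β x∈S) β<γ ; (inj₂ x∈T) → T<γ x∈T }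
    ... | tri≈ _ refl _ = β , λ { (inj₁ x∈S) → S<β x∈S ; (inj₂ x∈T) → T<γ x∈T }
    ... | tri> _ _ γ<β = β , λ { (inj₁ x∈S) → S<β x∈S ; (inj₂ x∈T) → <-trans (T<γ x∈T) γ<β }

    bool-≺ : {A : Setoid ℓ ℓ} → A ≼ setoid Bool → A ≺ ∣ κ ∣
    bool-≺ A≼Bool = ≼-trans A≼Bool Bool≼κ , λ κ≼A →
      pigeonhole (≼-trans infinite (≼-trans κ≼A A≼Bool))
      where
      Bool≼κ : setoid Bool ≼ ∣ κ ∣
      Bool≼κ = record
        { to        = λ b → element (if b then 1 else 0)
        ; cong      = cong λ b → element (if b then 1 else 0)
        ; injective = λ
          { {true}  {true}  _  → refl
          ; {true}  {false} eq → contradiction (element-injective eq) λ ()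
          ; {false} {true}  eq → contradiction (element-injective eq) λ ()
          ; {false} {false} _  → refl
          }
        }

      pigeonhole : ¬ (setoid ℕ ≼ setoid Bool)
      pigeonhole e with to 0 | to 1 | to 2 | injective {0} {1} | injective {0} {2} | injective {1} {2}
        where open Injection e
      ... | true  | true  | _     | inj | _   | _   = contradiction (inj refl) λ ()
      ... | false | false | _     | inj | _   | _   = contradiction (inj refl) λ ()
      ... | true  | false | true  | _   | inj | _   = contradiction (inj refl) λ ()
      ... | false | true  | false | _   | inj | _   = contradiction (inj refl) λ ()
      ... | true  | false | false | _   | _   | inj = contradiction (inj refl) λ ()
      ... | false | true  | true  | _   | _   | inj = contradiction (inj refl) λ ()

    list-bounded : ∀ xs → Bounded (_∈ˡ xs)
    list-bounded [] = element 0 , λ ()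
    list-bounded (x ∷ xs) = bounded-mono
      (λ { (here y≡x) → inj₁ y≡x ; (there y∈xs) → inj₂ y∈xs })
      (∪-bounded (small⇒bounded (proj₂ (bool-≺ singleton))) (list-bounded xs))
      where
      singleton : subsetoid ∣ κ ∣ (_≡ x) ≼ setoid Bool
      singleton = record
        { to = λ _ → true ; cong = λ _ → refl
        ; injective = λ {(y , y≡x)} {(z , z≡x)} _ → trans y≡x (sym z≡x) }

    -- Each element of a well-order is sent to the least ordinal that is not the
    -- image of a smaller element.

    wellOrder-≼ : (W : Setoid ℓ ℓ) {_⊏_ : Rel (Setoid.Carrier W) ℓ} →
                  IsStrictTotalOrder (Setoid._≈_ W) _⊏_ → WellFounded _⊏_ →
                  ¬ (∣ κ ∣ ≼ W) → W ≼ ∣ κ ∣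
    wellOrder-≼ W {_⊏_} sto wf κ⋠W = record
      { to        = rank ∘ wf
      ; cong      = rank-cong (wf _) (wf _)
      ; injective = injective
      }
      where
      open Setoid W using (_≈_) renaming (Carrier to C; refl to ≈-refl; sym to ≈-sym)
      open IsStrictTotalOrder sto using () renaming (compare to ⊏-compare; <-respʳ-≈ to ⊏-respʳ-≈)

      smallest : Pred Carrier ℓ → Carrier
      smallest P with em {P = ∃ P}
      ... | yes ∃P = proj₁ (minimal-exists ∃P)
      ... | no  _  = element 0

      smallest-∈ : ∀ {P} → ∃ P → smallest P ∈ P
      smallest-∈ {P} x with em {P = ∃ P}
      ... | yes ∃P = proj₁ (proj₂ (minimal-exists ∃P))
      ... | no ∄P  = contradiction x ∄P

      smallest-cong : ∀ {P Q} → P ≐ Q → smallest P ≡ smallest Q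
      smallest-cong {P} {Q} P≐Q with em {P = ∃ P} | em {P = ∃ Q}
      ... | yes ∃P | yes ∃Q = minimal-unique P≐Q (proj₂ (minimal-exists ∃P)) (proj₂ (minimal-exists ∃Q))
      ... | yes (x , x∈P) | no ∄Q = contradiction (x , proj₁ P≐Q x∈P) ∄Q
      ... | no ∄P | yes (x , x∈Q) = contradiction (x , proj₂ P≐Q x∈Q) ∄P
      ... | no _ | no _ = refl

      rank : ∀ {w} → Acc _⊏_ w → Carrier
      rank {w} (acc rs) = smallest λ x → ∀ {v} (v⊏w : v ⊏ w) → rank (rs v⊏w) ≢ x

      -- Since `rank` recurses on the accessibility proof, independence of that proof and of the
      -- representative is shown in one induction.
      rank-cong : ∀ {w w′} (α : Acc _⊏_ w) (α′ : Acc _⊏_ w′) → w ≈ w′ → rank α ≡ rank α′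
      rank-cong (acc rs) (acc rs′) w≈w′ = smallest-cong
        ( (λ new v⊏w′ eq → let v⊏w = ⊏-respʳ-≈ (≈-sym w≈w′) v⊏w′ in
             new v⊏w (trans (rank-cong (rs v⊏w) (rs′ v⊏w′) ≈-refl) eq))
        , (λ new v⊏w eq → let v⊏w′ = ⊏-respʳ-≈ w≈w′ v⊏w in
             new v⊏w′ (trans (sym (rank-cong (rs v⊏w) (rs′ v⊏w′) ≈-refl)) eq)) )

      rank-new : ∀ {v w} (α : Acc _⊏_ w) → v ⊏ w → rank (wf v) ≢ rank α
      rank-new {v} {w} (acc rs) v⊏w eq = smallest-∈ new-exists v⊏w
        (trans (rank-cong (rs v⊏w) (wf v) ≈-refl) eq)
        where
        -- If no value were new, every element of κ would be a rank, and choosing a preimage for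
        -- each would inject κ into `W`.
        new-exists : ∃[ x ] (∀ {v} (v⊏w : v ⊏ w) → rank (rs v⊏w) ≢ x)
        new-exists = byContradiction λ ∄new →
          let attained : ∀ x → ∃[ u ] rank (wf u) ≡ x
              attained x = byContradiction λ x∉ → ∄new (x , λ {u} u⊏w eq′ →
                x∉ (u , trans (rank-cong (wf u) (rs u⊏w) ≈-refl) eq′))
          in κ⋠W record
            { to        = proj₁ ∘ attained
            ; cong      = λ { refl → ≈-refl }
            ; injective = λ {x} {y} u≈v → trans (sym (proj₂ (attained x)))
                (trans (rank-cong (wf _) (wf _) u≈v) (proj₂ (attained y)))
            }

      injective : ∀ {v w} → rank (wf v) ≡ rank (wf w) → v ≈ w
      injective {v} {w} eq with ⊏-compare v w
      ... | tri< v⊏w _ _ = contradiction eq (rank-new (wf w) v⊏w)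
      ... | tri≈ _ v≈w _ = v≈w
      ... | tri> _ _ w⊏v = contradiction (sym eq) (rank-new (wf v) w⊏v)

    -- S is well-ordered by an injection into κ × κ, so only κ ⋠ S remains.

    fibred-≺ : {S I : Setoid ℓ ℓ} (φ : Func S I) → I ≺ ∣ κ ∣ →
               (∀ i → subsetoid S (λ s → Setoid._≈_ I (Func.to φ s) i) ≺ ∣ κ ∣) →
               S ≺ ∣ κ ∣
    fibred-≺ {S} {I} φ (I≼κ , κ⋠I) fibre-≺ = S≼κ , κ⋠S
      where
      open Setoid S using () renaming (Carrier to ∥S∥; _≈_ to _≈ˢ_)
      open Setoid I using () renaming (_≈_ to _≈ⁱ_; sym to ≈ⁱ-sym; trans to ≈ⁱ-trans)
      open Func φ using () renaming (to to ⟦_⟧; cong to ⟦⟧-cong)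
      module e = Injection I≼κ

      -- Such an injection would cut κ into fibres over `I`, each bounded because it is small. Their
      -- union is bounded by regularity, yet it is all of κ.
      κ⋠S : ¬ (∣ κ ∣ ≼ S)
      κ⋠S κ≼S =
        let β , <β = ⋃-bounded I κ⋠I (λ i x → ⟦ g.to x ⟧ ≈ⁱ i)
                       (λ i≈j x∈i → ≈ⁱ-trans x∈i i≈j)
                       (λ i → small⇒bounded λ κ≼T → proj₂ (fibre-≺ i) (≼-trans κ≼T record
                         { to = λ (x , x∈i) → g.to x , x∈i ; cong = g.cong ; injective = g.injective }))
        in <-irrefl (<β (⟦ g.to β ⟧ , Setoid.refl I))
        where module g = Injection κ≼S

      -- Indexed by elements of κ under `_≡_` instead of elements of `I` under `_≈ⁱ_`: equal indices
      -- then give the same type, and `canonical` the same injection.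
      Fibre : Pred Carrier ℓ
      Fibre x = subsetoid S (λ s → e.to ⟦ s ⟧ ≡ x) ≼ ∣ κ ∣

      fibre-≼ : ∀ s → Fibre (e.to ⟦ s ⟧)
      fibre-≼ s = ≼-trans (subsetoid-mono {A = S} e.injective) (proj₁ (fibre-≺ ⟦ s ⟧))

      ψ : ∥S∥ → Carrier × Carrier
      ψ s = e.to ⟦ s ⟧ , Injection.to (canonical (fibre-≼ s)) (s , refl)

      compatible : ∀ {x y} (ξ : Fibre x) (υ : Fibre y) (s t : ∥S∥)
                   (s∈x : e.to ⟦ s ⟧ ≡ x) (t∈y : e.to ⟦ t ⟧ ≡ y) → x ≡ y →
                   (s ≈ˢ t → Injection.to (canonical ξ) (s , s∈x) ≡ Injection.to (canonical υ) (t , t∈y)) ×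
                   (Injection.to (canonical ξ) (s , s∈x) ≡ Injection.to (canonical υ) (t , t∈y) → s ≈ˢ t)
      compatible ξ υ s t s∈x t∈y refl rewrite canonical-const ξ υ =
        Injection.cong (canonical υ) , Injection.injective (canonical υ)

      _⊏_ : Rel (Carrier × Carrier) ℓ
      _⊏_ = ×-Lex _≡_ _<_ _<_

      W : Setoid ℓ ℓ
      W = On.setoid (∣ κ ∣ ×ₛ ∣ κ ∣) ψ

      S≼W : S ≼ W
      S≼W = record
        { to        = id
        ; cong      = λ {s} {t} s≈t → let eq = e.cong (⟦⟧-cong s≈t) in
            eq , proj₁ (compatible (fibre-≼ s) (fibre-≼ t) s t refl refl eq) s≈t
        ; injective = λ {s} {t} (eq , eq′) →
            proj₂ (compatible (fibre-≼ s) (fibre-≼ t) s t refl refl eq) eq′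
        }

      W≼S : W ≼ S
      W≼S = record
        { to = id ; cong = Injection.injective S≼W ; injective = Injection.cong S≼W }

      S≼κ : S ≼ ∣ κ ∣
      S≼κ = ≼-trans S≼W (wellOrder-≼ W
        (On.isStrictTotalOrder ψ (×-isStrictTotalOrder isStrictTotalOrder isStrictTotalOrder))
        (On.wellFounded ψ (×-wellFounded wellFounded wellFounded))
        (λ κ≼W → κ⋠S (≼-trans κ≼W W≼S)))

    -- Sending `s` to the least index of a piece containing it defines a map to `χ` whose fibres lie
    -- inside the pieces.
    covered-≺ : (χ : Cardinal ℓ) → χ <ᶜ κ → {S : Setoid ℓ ℓ} →
                (P : Cardinal.Carrier χ → Pred (Setoid.Carrier S) ℓ) →
                (∀ x → P x Respects Setoid._≈_ S) → (∀ s → ∃[ x ] s ∈ P x) →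
                (∀ x → subsetoid S (P x) ≺ ∣ κ ∣) → S ≺ ∣ κ ∣
    covered-≺ χ χ<κ {S} P resp covers P-≺ = fibred-≺ least χ<κ λ x →
      ≼-≺-trans (subsetoid-mono {A = S} λ {s} eq → subst (λ x → s ∈ P x) eq (proj₁ (least-minimal s))) (P-≺ x)
      where
      open Setoid S using () renaming (sym to ≈-sym)
      module χ-Minimum = Minimum (Cardinal.isStrictTotalOrder χ) (Cardinal.wellFounded χ)

      least-minimal : ∀ s → proj₁ (χ-Minimum.minimal-exists (covers s)) ∈ χ-Minimum.Minimal (λ x → s ∈ P x)
      least-minimal s = proj₂ (χ-Minimum.minimal-exists (covers s))

      least : Func S ∣ χ ∣
      least = record
        { to   = λ s → proj₁ (χ-Minimum.minimal-exists (covers s))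
        ; cong = λ {s} {t} s≈t → χ-Minimum.minimal-unique
            ((λ {x} → resp x s≈t) , (λ {x} → resp x (≈-sym s≈t))) (least-minimal s) (least-minimal t)
        }

    ×-≺ : {A B : Setoid ℓ ℓ} → A ≺ ∣ κ ∣ → B ≺ ∣ κ ∣ → (A ×ₛ B) ≺ ∣ κ ∣
    ×-≺ {A} {B} A≺κ B≺κ = fibred-≺ record { to = proj₁ ; cong = proj₁ } A≺κ λ a →
      ≼-≺-trans {B = B} record
        { to        = proj₂ ∘ proj₁
        ; cong      = proj₂
        ; injective = λ {((x , _) , x≈a)} {((y , _) , y≈a)} → Setoid.trans A x≈a (Setoid.sym A y≈a) ,_
        } B≺κ

    -- Turns the failure of an inequality in (1) into a strict bound, from which the size estimates
    -- for the counterexample start.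
    cardinal-≺ : (χ : Cardinal ℓ) → ¬ (κ ≤ᶜ χ) → χ <ᶜ κ
    cardinal-≺ χ κ⋠χ =
      wellOrder-≼ ∣ χ ∣ (Cardinal.isStrictTotalOrder χ) (Cardinal.wellFounded χ) κ⋠χ , κ⋠χ

  -- Truth values, Boolean functions and their supports

  truth : Set a → Bool
  truth A = ⌊ em {P = A} ⌋

  truth⁺ : {A : Set a} → A → truth A ≡ true
  truth⁺ {A = A} x with em {P = A}
  ... | yes _ = refl
  ... | no ¬A = contradiction x ¬A

  truth⁻ : {A : Set a} → truth A ≡ true → A
  truth⁻ {A = A} eq with em {P = A}
  ... | yes x = x

  truth-false : {A : Set a} → ¬ A → truth A ≡ false
  truth-false {A = A} ¬A with em {P = A}
  ... | yes x = contradiction x ¬A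
  ... | no _  = refl

  truth-cong : {A : Set a} {B : Set b} → (A → B) → (B → A) → truth A ≡ truth B
  truth-cong {A = A} {B} A→B B→A with em {P = A} | em {P = B}
  ... | yes _ | yes _ = refl
  ... | yes x | no ¬B = contradiction (A→B x) ¬B
  ... | no ¬A | yes y = contradiction (B→A y) ¬A
  ... | no _  | no _  = refl

  module BooleanFunctions (X : Set ℓ) where

    Valuation : Set ℓ
    Valuation = X → Bool

    Function : Set ℓ
    Function = Valuation → Bool

    functions : Setoid ℓ ℓ
    functions = Valuation →-setoid Bool

    Agree : Pred X p → Rel Valuation _
    Agree S v w = ∀ x → x ∈ S → v x ≡ w x

    Supports : Function → Pred (Pred X p) _
    Supports f S = ∀ v w → Agree S v w → f v ≡ f w

    supports-mono : ∀ f {S : Pred X p} {T : Pred X q} → S ⊆ T → Supports f S → Supports f T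
    supports-mono f S⊆T f-S v w agree = f-S v w λ x x∈S → agree x (S⊆T x∈S)

    supports-resp : ∀ {f g} → f ≗ g → {S : Pred X p} → Supports f S → Supports g S
    supports-resp f≗g f-S v w agree = trans (sym (f≗g v)) (trans (f-S v w agree) (f≗g w))

    SupportedBy : List X → Pred Function ℓ
    SupportedBy xs f = Supports f (_∈ˡ xs)

    FinitelySupported : Pred Function ℓ
    FinitelySupported f = ∃[ xs ] f ∈ SupportedBy xs

    finitelySupported-const : ∀ b → (λ _ → b) ∈ FinitelySupported
    finitelySupported-const b = [] , λ _ _ _ → refl

    finitelySupported-zip : ∀ (_∙_ : Bool → Bool → Bool) {f g} → f ∈ FinitelySupported →
                            g ∈ FinitelySupported → (λ v → f v ∙ g v) ∈ FinitelySupported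
    finitelySupported-zip _∙_ {f} {g} (xs , f-xs) (ys , g-ys) = xs ++ ys , λ v w agree → cong₂ _∙_
      (supports-mono f ∈-++⁺ˡ f-xs v w agree) (supports-mono g (∈-++⁺ʳ xs) g-ys v w agree)

    override : Pred X p → Valuation → Valuation → Valuation
    override S v w x = if truth (x ∈ S) then v x else w x

    override-agreeˡ : (S : Pred X p) → ∀ v w → Agree S (override S v w) v
    override-agreeˡ S v w x x∈S with em {P = x ∈ S}
    ... | yes _  = refl
    ... | no x∉S = contradiction x∈S x∉S

    override-agreeʳ : (S : Pred X p) (T : Pred X q) → ∀ v w →
                      Agree (S ∩ T) v w → Agree T (override S v w) w
    override-agreeʳ S T v w agree x x∈T with em {P = x ∈ S}
    ... | yes x∈S = agree x (x∈S , x∈T)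
    ... | no _    = refl

    -- The hybrid of `v` on `S` and `w` elsewhere agrees with `v` on `S` and, as `v` and `w` agree
    -- on the intersection, with `w` on `T`.
    supports-∩ : ∀ f {S : Pred X p} {T : Pred X q} → Supports f S → Supports f T → Supports f (S ∩ T)
    supports-∩ f {S} {T} f-S f-T v w agree = trans
      (sym (f-S _ _ (override-agreeˡ S v w)))
      (f-T _ _ (override-agreeʳ S T v w agree))

    -- The essential variables of a finitely supported `f`. Lying in every finite support is built
    -- in, so only `supports-core` has to be proved.
    Core : Function → Pred X ℓ
    Core f x = ∀ xs → f ∈ SupportedBy xs → x ∈ˡ xs

    -- The core may intersect infinitely many supports, but finitely many suffice: starting from
    -- `xs`, each entry outside the core is removed by intersecting with one support that omits it.
    supports-core : ∀ f → f ∈ FinitelySupported → Supports f (Core f)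
    supports-core f (xs , f-xs) = supports-mono f (λ (x∈xs , core) → core x∈xs) (prune xs)
      where
      Pruned : List X → Pred X ℓ
      Pruned ys x = x ∈ˡ xs × (x ∈ˡ ys → x ∈ Core f)

      prune : ∀ ys → Supports f (Pruned ys)
      prune [] = supports-mono f (λ x∈xs → x∈xs , λ ()) f-xs
      prune (y ∷ ys) with em {P = ∃[ zs ] f ∈ SupportedBy zs × ¬ (y ∈ˡ zs)}
      ... | yes (zs , f-zs , y∉zs) = supports-mono f
        (λ ((x∈xs , core) , x∈zs) → x∈xs , λ
          { (here refl) → contradiction x∈zs y∉zs ; (there x∈ys) → core x∈ys })
        (supports-∩ f (prune ys) f-zs)
      ... | no y∈core = supports-mono f
        (λ (x∈xs , core) → x∈xs , λ
          { (here refl) zs f-zs → byContradiction λ y∉zs → y∈core (zs , f-zs , y∉zs)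
          ; (there x∈ys) → core x∈ys })
        (prune ys)

    -- Existential quantification over the variables outside `S`; with `S` the core of the larger
    -- function it yields the Craig interpolant.
    project : Pred X p → Function → Function
    project S f v = truth (∃[ w ] Agree S v w × f w ≡ true)

    project-supports : ∀ f (S : Pred X p) → Supports (project S f) S
    project-supports f S v w agree = truth-cong
      (λ (u , v~u , fu) → u , (λ x x∈S → trans (sym (agree x x∈S)) (v~u x x∈S)) , fu)
      (λ (u , w~u , fu) → u , (λ x x∈S → trans (agree x x∈S) (w~u x x∈S)) , fu)

    -- A witness `u` for `v` becomes one for `w` by keeping it on `T`, which preserves the value of
    -- `f`, and using `w` elsewhere. On `S ∩ T` all three coincide, so the result agrees with `w` on
    -- `S`.
    project-preserves : ∀ f (S : Pred X p) {T : Pred X q} → Supports f T → Supports (project S f) T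
    project-preserves f S {T} f-T v w agree =
      truth-cong (transfer agree) (transfer λ x x∈T → sym (agree x x∈T))
      where
      transfer : ∀ {v w} → Agree T v w →
                 ∃[ u ] Agree S v u × f u ≡ true → ∃[ u ] Agree S w u × f u ≡ true
      transfer {v} {w} v~w (u , v~u , fu) =
        override T u w
        , (λ x x∈S → sym (override-agreeʳ T S u w
             (λ y (y∈T , y∈S) → trans (sym (v~u y y∈S)) (v~w y y∈T)) x x∈S))
        , trans (f-T _ _ (override-agreeˡ T u w)) fu

    project-upper : ∀ f (S : Pred X p) {v} → f v ≡ true → project S f v ≡ true
    project-upper f S fv = truth⁺ (_ , (λ _ _ → refl) , fv)

    project-least : ∀ f g {S : Pred X p} → Supports g S → (∀ {v} → f v ≡ true → g v ≡ true) →
                    ∀ {v} → project S f v ≡ true → g v ≡ true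
    project-least f g g-S f≤g {v} fv =
      let w , v~w , fw = truth⁻ fv in trans (g-S v w v~w) (f≤g fw)

    branch : X → Function → Bool → Function
    branch x f b v = f (override (_≡ x) (λ _ → b) v)

    branch-supported : ∀ {x xs} f b → f ∈ SupportedBy (x ∷ xs) → branch x f b ∈ SupportedBy xs
    branch-supported {x} {xs} f b f-xs v w agree = f-xs _ _ overridden-agree
      where
      overridden-agree : Agree (_∈ˡ (x ∷ xs)) (override (_≡ x) (λ _ → b) v) (override (_≡ x) (λ _ → b) w)
      overridden-agree y y∈ with em {P = y ≡ x} | y∈
      ... | yes _  | _           = refl
      ... | no y≢x | here y≡x    = contradiction y≡x y≢x
      ... | no y≢x | there y∈xs  = agree y y∈xs

    -- The overridden valuation equals `v` only pointwise; the finite support serves to make `f`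
    -- respect pointwise equality.
    branch-determines : ∀ {f} x → f ∈ FinitelySupported → ∀ v → branch x f (v x) v ≡ f v
    branch-determines x (xs , f-xs) v = f-xs _ _ λ y _ → override-same y
      where
      override-same : ∀ y → override (_≡ x) (λ _ → v x) v y ≡ v y
      override-same y with em {P = y ≡ x}
      ... | yes refl = refl
      ... | no _     = refl

    -- Counting finitely supported functions

    module _ (κ : Cardinal ℓ) (κ-regular : IsRegularInfinite κ) where

      open RegularCardinal κ κ-regular

      -- The two Shannon cofactors of a function at `x` determine it, so `Q` embeds into the square
      -- of `P`.
      branches-≺ : ∀ x {P Q : Pred Function ℓ} → Q ⊆ FinitelySupported →
                   (∀ {f} → f ∈ Q → ∀ b → branch x f b ∈ P) →
                   subsetoid functions P ≺ ∣ κ ∣ → subsetoid functions Q ≺ ∣ κ ∣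
      branches-≺ x {P} Q-finite Q-branch P≺κ =
        ≼-≺-trans {B = subsetoid functions P ×ₛ subsetoid functions P} record
          { to        = λ (f , f∈Q) →
              (branch x f false , Q-branch f∈Q false) , (branch x f true , Q-branch f∈Q true)
          ; cong      = λ f≗g → (λ v → f≗g _) , (λ v → f≗g _)
          ; injective = λ {(f , f∈Q)} {(g , g∈Q)} (eq₀ , eq₁) v →
              let branches-equal : ∀ b → branch x f b v ≡ branch x g b v
                  branches-equal = λ { false → eq₀ v ; true → eq₁ v }
              in trans (sym (branch-determines x (Q-finite f∈Q) v))
                   (trans (branches-equal (v x)) (branch-determines x (Q-finite g∈Q) v))
          } (×-≺ P≺κ P≺κ)

      supportedBy-≺ : ∀ xs → subsetoid functions (SupportedBy xs) ≺ ∣ κ ∣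
      supportedBy-≺ [] = bool-≺ record
        { to        = λ (f , _) → f (λ _ → false)
        ; cong      = λ f≗g → f≗g _
        ; injective = λ {(f , f-const)} {(g , g-const)} eq v →
            trans (f-const _ _ λ _ ()) (trans eq (g-const _ _ λ _ ()))
        }
      supportedBy-≺ (x ∷ xs) =
        branches-≺ x (_ ,_) (λ {f} f-xs b → branch-supported f b f-xs) (supportedBy-≺ xs)

  module _ (χ κ : Cardinal ℓ) (χ-infinite : Infinite χ) (κ-regular : IsRegularInfinite κ)
           (χ<κ : χ <ᶜ κ) where

    open RegularCardinal κ κ-regular using (covered-≺)
    open BooleanFunctions (Cardinal.Carrier χ)
    open Injection χ-infinite using () renaming (to to element; injective to element-injective)

    SupportSize : ℕ → Pred Function ℓ
    SupportSize n f = ∃[ xs ] length xs ≡ n × f ∈ SupportedBy xs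

    -- The functions are sorted by the first entry of a supporting list, giving `χ` many pieces; in
    -- each piece the cofactors at that entry have supporting lists of length `n`.
    supportSize-≺ : ∀ n → subsetoid functions (SupportSize n) ≺ ∣ κ ∣
    supportSize-≺ zero = ≼-≺-trans
      (subsetoid-mono {A = functions} λ { ([] , _ , f-const) → f-const }) (supportedBy-≺ κ κ-regular [])
    supportSize-≺ (suc n) = covered-≺ χ χ<κ
      (λ x (f , _) → Head x f)
      (λ { x f≗g (xs , eq , f-xs) → xs , eq , supports-resp f≗g f-xs })
      (λ { (f , x ∷ xs , eq , f-xs) → x , xs , ℕ.suc-injective eq , f-xs })
      (λ x → ≼-≺-trans {B = subsetoid functions (Head x)}
        record { to = λ ((f , _) , f-x) → f , f-x ; cong = id ; injective = id }
        (branches-≺ κ κ-regular x (λ (xs , _ , f-xs) → x ∷ xs , f-xs)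
          (λ {f} (xs , eq , f-xs) b → xs , eq , branch-supported f b f-xs)
          (supportSize-≺ n)))
      where
      Head : Cardinal.Carrier χ → Pred Function ℓ
      Head x f = ∃[ xs ] length xs ≡ n × f ∈ SupportedBy (x ∷ xs)

    finitelySupported-≺ : subsetoid functions FinitelySupported ≺ ∣ κ ∣
    finitelySupported-≺ = covered-≺ χ χ<κ
      (λ x (f , _) → SupportSize (index x) f)
      (λ { x f≗g (xs , eq , f-xs) → xs , eq , supports-resp f≗g f-xs })
      (λ (f , xs , f-xs) → element (length xs) , xs , sym (index-element (length xs)) , f-xs)
      (λ x → ≼-≺-trans {B = subsetoid functions (SupportSize (index x))}
        record { to = λ ((f , _) , f-x) → f , f-x ; cong = id ; injective = id }
        (supportSize-≺ (index x)))
      where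
      index : Cardinal.Carrier χ → ℕ
      index x with em {P = ∃[ n ] element n ≡ x}
      ... | yes (n , _) = n
      -- The copy of ℕ in `χ` encodes the lengths of supports; elements outside it merely repeat the
      -- piece of length 0.
      ... | no _        = 0

      index-element : ∀ n → index (element n) ≡ n
      index-element n with em {P = ∃[ m ] element m ≡ element n}
      ... | yes (m , eq) = element-injective eq
      ... | no ∄m        = contradiction (n , refl) ∄m

  -- Criteria for and against the FN property

  -- An endpoint always interpolates when `f` offers the whole order and `g` only the class of its
  -- argument.
  small⇒FN : (μ κ : Cardinal ℓ) → IsRegularInfinite κ → (P : Poset ℓ ℓ ℓ) →
             Poset.Eq.setoid P ≺ ∣ μ ∣ → FN μ κ P
  small⇒FN {ℓ} μ κ κ-regular P P≺μ = record
    { f = record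
      { to   = λ _ → record
        { elements = λ _ → Lift ℓ ⊤
        ; resp     = λ _ _ → _
        ; small    = ≼-≺-trans {B = Eq.setoid}
            record { to = proj₁ ; cong = id ; injective = id } P≺μ
        }
      ; cong = λ _ → id , id
      }
    ; g = record
      { to   = λ p → record
        { elements = p ≈_
        ; resp     = λ q≈r p≈q → Eq.trans p≈q q≈r
        ; small    = RegularCardinal.bool-≺ κ κ-regular record
          { to        = λ _ → true
          ; cong      = λ _ → refl
          ; injective = λ {(_ , p≈q)} {(_ , p≈r)} _ → Eq.trans (Eq.sym p≈q) p≈r
          }
        }
      ; cong = λ p≈q → Eq.trans (Eq.sym p≈q) , Eq.trans p≈q
      }
    ; interpolate-fg = λ {_} {q} p≤q → q , (_ , Eq.refl) , p≤q , ≤-refl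
    ; interpolate-gf = λ {p} p≤q → p , (Eq.refl , _) , ≤-refl , p≤q
    }
    where open Poset P using (_≈_; module Eq) renaming (refl to ≤-refl)

  module Gap (μ κ : Cardinal ℓ) (μ-regular : IsRegularInfinite μ) (κ-regular : IsRegularInfinite κ)
             (κ<μ : κ <ᶜ μ) (P : Poset ℓ ℓ ℓ) where

    open Poset P using (_≤_; module Eq; ≤-respˡ-≈; ≤-respʳ-≈) renaming (Carrier to ∥P∥)
    module μ = RegularCardinal μ μ-regular
    module κ = RegularCardinal κ κ-regular

    -- β exceeds every j such that r ≤ upper j for an r in some F (lower i) that
    -- is below few upper j. So any r interpolating lower i ≤ upper β is below many
    -- upper j, hence above few lower i, and G (upper β) is too small to contain
    -- such r for all i.

    gap⇒¬FN : (lower : Cardinal.Carrier κ → ∥P∥) (upper : Cardinal.Carrier μ → ∥P∥) →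
              (∀ i j → lower i ≤ upper j) →
              (∀ r → κ.Bounded (λ i → lower i ≤ r) ⊎ μ.Bounded (λ j → r ≤ upper j)) →
              ¬ FN μ κ P
    gap⇒¬FN lower upper lower≤upper gap fn =
      let β , <β = above-F
          γ , <γ = κ.⋃-bounded (subsetoid Eq.setoid (G (upper β)))
            (proj₂ (SmallSubset.small (Func.to g (upper β))))
            (λ (r , _) → Few-lower r) few-lower-resp (λ (r , _) → few-lower-bounded r)
          r , (r∈F , r∈G) , γ≤r , r≤β = interpolate-fg (lower≤upper γ β)
      in case gap r of λ
        { (inj₁ few) → κ.<-irrefl (<γ ((r , r∈G) , few , γ≤r))
        ; (inj₂ few) → μ.<-irrefl (<β (γ , (r , r∈F) , few , r≤β))
        }
      where
      open FN fn

      -- The first conjunct empties the set when `r` is above unboundedly many `lower i`, so the set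
      -- is bounded for every `r`.
      Few-lower : ∥P∥ → Pred (Cardinal.Carrier κ) ℓ
      Few-lower r i = κ.Bounded (λ i → lower i ≤ r) × lower i ≤ r

      Few-upper : ∥P∥ → Pred (Cardinal.Carrier μ) ℓ
      Few-upper r j = μ.Bounded (λ j → r ≤ upper j) × r ≤ upper j

      few-lower-resp : ∀ {r s} → r Eq.≈ s → Few-lower r ⊆ Few-lower s
      few-lower-resp r≈s (few , i≤r) = κ.bounded-mono (≤-respʳ-≈ (Eq.sym r≈s)) few , ≤-respʳ-≈ r≈s i≤r

      few-upper-resp : ∀ {r s} → r Eq.≈ s → Few-upper r ⊆ Few-upper s
      few-upper-resp r≈s (few , r≤j) = μ.bounded-mono (≤-respˡ-≈ (Eq.sym r≈s)) few , ≤-respˡ-≈ r≈s r≤j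

      few-lower-bounded : ∀ r → κ.Bounded (Few-lower r)
      few-lower-bounded r with em {P = κ.Bounded (λ i → lower i ≤ r)}
      ... | yes few = κ.bounded-mono proj₂ few
      ... | no many = κ.element 0 , λ (few , _) → contradiction few many

      few-upper-bounded : ∀ r → μ.Bounded (Few-upper r)
      few-upper-bounded r with em {P = μ.Bounded (λ j → r ≤ upper j)}
      ... | yes few = μ.bounded-mono proj₂ few
      ... | no many = μ.element 0 , λ (few , _) → contradiction few many

      -- Regularity of `μ` enters twice: for the union over `i` in κ, and for the union over the
      -- fewer than `μ` elements of each `F (lower i)`.
      above-F : μ.Bounded (λ j → ∃[ i ] ∃[ r ] j ∈ Few-upper (proj₁ {B = F (lower i)} r))
      above-F = μ.⋃-bounded ∣ κ ∣ (proj₂ κ<μ) _ (λ { refl → id }) λ i →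
        μ.⋃-bounded (subsetoid Eq.setoid (F (lower i))) (proj₂ (SmallSubset.small (Func.to f (lower i))))
          (λ (r , _) → Few-upper r) few-upper-resp (λ (r , _) → few-upper-bounded r)

  -- The Boolean algebra of two glued Cantor cubes

  -- The Stone space consists of the valuations of X ⊎ Y that are false on X or
  -- true on Y; the two parts share the point that is false on X and true on Y.

  module Amalgam (X Y : Set ℓ) where

    module X = BooleanFunctions X
    module Y = BooleanFunctions Y

    -- The clopen subsets of the glued space: finite support is continuity on each cube, and the
    -- last equation says that both parts give the common point the same value.
    Amalgamated : Pred (X.Valuation ⊎ Y.Valuation → Bool) ℓ
    Amalgamated f = f ∘ inj₁ ∈ X.FinitelySupported × f ∘ inj₂ ∈ Y.FinitelySupported
                  × f (inj₁ λ _ → false) ≡ f (inj₂ λ _ → true)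

    algebra : BooleanAlgebra ℓ ℓ
    algebra = functionAlgebra Amalgamated
      (λ b → X.finitelySupported-const b , Y.finitelySupported-const b , refl)
      (λ _∙_ (f-X , f-Y , f-base) (g-X , g-Y , g-base) →
        X.finitelySupported-zip _∙_ f-X g-X , Y.finitelySupported-zip _∙_ f-Y g-Y ,
        cong₂ _∙_ f-base g-base)

    poset : Poset ℓ ℓ ℓ
    poset = BooleanAlgebraProperties.poset algebra

    open Poset poset using (_≤_; _≈_; module Eq) renaming (Carrier to ∥A∥)

    ≤⇒true : ∀ {f g} → f ≤ g → ∀ z → proj₁ f z ≡ true → proj₁ g z ≡ true
    ≤⇒true {f , _} f≤g z fz with f z | f≤g z
    ... | true | eq = sym eq

    true⇒≤ : ∀ {f g} → (∀ z → proj₁ f z ≡ true → proj₁ g z ≡ true) → f ≤ g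
    true⇒≤ {f , _} imp z with f z | imp z
    ... | true  | gz = sym (gz refl)
    ... | false | _  = refl

    algebra≼ : Eq.setoid ≼ (subsetoid X.functions X.FinitelySupported ×ₛ
                            subsetoid Y.functions Y.FinitelySupported)
    algebra≼ = record
      { to        = λ (f , f-X , f-Y , _) → (f ∘ inj₁ , f-X) , (f ∘ inj₂ , f-Y)
      ; cong      = λ f≗g → f≗g ∘ inj₁ , f≗g ∘ inj₂
      ; injective = λ { (eqX , eqY) (inj₁ v) → eqX v ; (eqX , eqY) (inj₂ w) → eqY w }
      }

    lower : X → ∥A∥
    lower x = (λ { (inj₁ v) → v x ; (inj₂ _) → false }) ,
      (x ∷ [] , λ v w agree → agree x (here refl)) , Y.finitelySupported-const false , refl

    upper : Y → ∥A∥
    upper y = (λ { (inj₁ _) → true ; (inj₂ w) → w y }) ,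
      X.finitelySupported-const true , (y ∷ [] , λ v w agree → agree y (here refl)) , refl

    lower≤upper : ∀ x y → lower x ≤ upper y
    lower≤upper x y (inj₁ v) = sym (Bool.∧-identityʳ (v x))
    lower≤upper x y (inj₂ w) = refl

    -- Were `x` missing from `xs`, `f` could not tell the valuation true only at `x` from the common
    -- point, and would be false where `lower x` is true.
    lower≤⇒∈support : ∀ {f xs} → proj₁ f (inj₁ λ _ → false) ≡ false →
                      proj₁ f ∘ inj₁ ∈ X.SupportedBy xs → ∀ {x} → lower x ≤ f → x ∈ˡ xs
    lower≤⇒∈support {f} {xs} f-base f-xs {x} x≤f = byContradiction λ x∉xs →
      let v = λ y → truth (y ≡ x)
          fv : proj₁ f (inj₁ v) ≡ true
          fv = ≤⇒true {lower x} {f} x≤f (inj₁ v) (truth⁺ refl)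
          fv≡f-base : proj₁ f (inj₁ v) ≡ proj₁ f (inj₁ λ _ → false)
          fv≡f-base = f-xs _ _ λ y y∈xs → truth-false λ { refl → x∉xs y∈xs }
      in contradiction (trans (sym fv) (trans fv≡f-base f-base)) λ ()

    ≤upper⇒∈support : ∀ {f ys} → proj₁ f (inj₂ λ _ → true) ≡ true →
                      proj₁ f ∘ inj₂ ∈ Y.SupportedBy ys → ∀ {y} → f ≤ upper y → y ∈ˡ ys
    ≤upper⇒∈support {f} {ys} f-base f-ys {y} f≤y = byContradiction λ y∉ys →
      let w = λ z → not (truth (z ≡ y))
          fw : proj₁ f (inj₂ w) ≡ true
          fw = trans (f-ys _ _ λ z z∈ys → cong not (truth-false λ { refl → y∉ys z∈ys })) f-base
          wy : w y ≡ true
          wy = ≤⇒true {f} {upper y} f≤y (inj₂ w) fw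
      in contradiction (trans (sym wy) (cong not (truth⁺ refl))) λ ()

    -- Quantifying over all supports, not a chosen one, makes the set invariant under `_≈_`, while a
    -- single support already bounds its size.
    Tied : ∥A∥ → Pred ∥A∥ ℓ
    Tied (f , _) (g , _) = ∀ ys → f ∘ inj₂ ∈ Y.SupportedBy ys → g ∘ inj₂ ∈ Y.SupportedBy ys

    -- On the Y-part this is Craig interpolation. On the X-part either end will
    -- do, and the value at the common point decides which one.

    interpolant : ∀ {f g} → f ≤ g → ∃[ r ] (r ∈ Tied f × r ∈ Tied g) × f ≤ r × r ≤ g
    interpolant {f , f-X , f-Y , f-base} {g , g-X , g-Y , g-base} f≤g =
      -- Quantification keeps every support of `f₂` and leaves a function of the core of `g₂`, so
      -- `r` is tied to both ends.
      r , ( (λ ys f-ys → Y.project-preserves f₂ (Y.Core g₂) f-ys)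
          , (λ ys g-ys → Y.supports-mono d (λ core → core ys g-ys) (Y.project-supports f₂ (Y.Core g₂))) )
        , true⇒≤ {f , f-X , f-Y , f-base} {r} f≤r
        , true⇒≤ {r} {g , g-X , g-Y , g-base} r≤g
      where
      f⇒g : ∀ z → f z ≡ true → g z ≡ true
      f⇒g = ≤⇒true {f , f-X , f-Y , f-base} {g , g-X , g-Y , g-base} f≤g

      f₂ g₂ d : Y.Function
      f₂ = f ∘ inj₂
      g₂ = g ∘ inj₂
      d  = Y.project (Y.Core g₂) f₂

      f₂⇒d : ∀ {w} → f₂ w ≡ true → d w ≡ true
      f₂⇒d = Y.project-upper f₂ (Y.Core g₂)

      d⇒g₂ : ∀ {w} → d w ≡ true → g₂ w ≡ true
      d⇒g₂ = Y.project-least f₂ g₂ (Y.supports-core g₂ g-Y) (f⇒g _)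

      end : Bool → X.Function
      end b v = if b then g (inj₁ v) else f (inj₁ v)

      end-finite : ∀ b → end b ∈ X.FinitelySupported
      end-finite true  = g-X
      end-finite false = f-X

      -- Here `b` will be the value of `d` at the common point. As `d` lies between `f₂` and `g₂`,
      -- `g` is true there if `b` is, and `f` is false there otherwise; so the two parts of `r` fit
      -- together.
      end-base : ∀ b → (f₂ (λ _ → true) ≡ true → b ≡ true) → (b ≡ true → g₂ (λ _ → true) ≡ true) →
                 end b (λ _ → false) ≡ b
      end-base true  _   b⇒g = trans g-base (b⇒g refl)
      end-base false f⇒b _   = trans f-base (Bool.¬-not λ f₂-true → contradiction (f⇒b f₂-true) λ ())

      f≤end : ∀ b {v} → f (inj₁ v) ≡ true → end b v ≡ true
      f≤end true  = f⇒g _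
      f≤end false = id

      end≤g : ∀ b {v} → end b v ≡ true → g (inj₁ v) ≡ true
      end≤g true  = id
      end≤g false = f⇒g _

      r : ∥A∥
      r = (λ { (inj₁ v) → end (d λ _ → true) v ; (inj₂ w) → d w })
        , end-finite (d λ _ → true)
        , (proj₁ f-Y , Y.project-preserves f₂ (Y.Core g₂) (proj₂ f-Y))
        , end-base (d λ _ → true) f₂⇒d d⇒g₂

      f≤r : ∀ z → f z ≡ true → proj₁ r z ≡ true
      f≤r (inj₁ v) = f≤end (d λ _ → true)
      f≤r (inj₂ w) = f₂⇒d

      r≤g : ∀ z → proj₁ r z ≡ true → g z ≡ true
      r≤g (inj₁ v) = end≤g (d λ _ → true)
      r≤g (inj₂ w) = d⇒g₂

    interpolation⇒FN : (κ : Cardinal ℓ) → IsRegularInfinite κ →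
                       subsetoid X.functions X.FinitelySupported ≺ ∣ κ ∣ → FN κ κ poset
    interpolation⇒FN κ κ-regular X≺κ = record
      { f = tied ; g = tied
      ; interpolate-fg = λ {f} {g} → interpolant {f} {g}
      ; interpolate-gf = λ {f} {g} → interpolant {f} {g} }
      where
      -- The X-part ranges over fewer than κ functions by assumption, and the Y-part over those
      -- supported by one fixed list.
      tied-small : ∀ f → subsetoid Eq.setoid (Tied f) ≺ ∣ κ ∣
      tied-small (f , _ , (ys , f-ys) , _) = ≼-≺-trans record
          { to        = λ ((g , g-X , _) , tied) → (g ∘ inj₁ , g-X) , (g ∘ inj₂ , tied ys f-ys)
          ; cong      = λ f≗g → f≗g ∘ inj₁ , f≗g ∘ inj₂
          ; injective = λ { (eqX , eqY) (inj₁ v) → eqX v ; (eqX , eqY) (inj₂ w) → eqY w }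
          }
        (RegularCardinal.×-≺ κ κ-regular X≺κ (Y.supportedBy-≺ κ κ-regular ys))

      tied : Func Eq.setoid ([ Eq.setoid ]^< κ)
      tied = record
        { to   = λ f → record
          { elements = Tied f
          ; resp     = λ g≗h f-g ys f-ys → Y.supports-resp (g≗h ∘ inj₂) (f-g ys f-ys)
          ; small    = tied-small f
          }
        ; cong = λ f≗g →
            (λ f-h ys g-ys → f-h ys (Y.supports-resp (λ w → sym (f≗g (inj₂ w))) g-ys))
          , (λ g-h ys f-ys → g-h ys (Y.supports-resp (f≗g ∘ inj₂) f-ys))
        }

  -- The counterexample and the equivalence

  module _ (μ κ : Cardinal ℓ) (μ-regular : IsRegularInfinite μ) (κ-regular : IsRegularInfinite κ)
           (κ<μ : κ <ᶜ μ) where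

    open Amalgam (Cardinal.Carrier κ) (Cardinal.Carrier μ)

    amalgam-¬FN : ¬ FN μ κ poset
    amalgam-¬FN = Gap.gap⇒¬FN μ κ μ-regular κ-regular κ<μ poset lower upper lower≤upper gap
      where
      module μ = RegularCardinal μ μ-regular
      module κ = RegularCardinal κ κ-regular

      open Poset poset using (_≤_)

      Gap : Pred (Poset.Carrier poset) _
      Gap r = κ.Bounded (λ i → lower i ≤ r) ⊎ μ.Bounded (λ j → r ≤ upper j)

      gap : ∀ r → Gap r
      gap r@(f , (xs , f-xs) , (ys , f-ys) , base) = split (f (inj₁ λ _ → false)) refl
        where
        split : ∀ b → f (inj₁ λ _ → false) ≡ b → Gap r
        split false eq = inj₁ (κ.bounded-mono (lower≤⇒∈support {r} eq f-xs) (κ.list-bounded xs))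
        split true  eq = inj₂ (μ.bounded-mono (≤upper⇒∈support {r} (trans (sym base) eq) f-ys)
                                         (μ.list-bounded ys))

    amalgam-≺ : (ν : Cardinal ℓ) → IsRegularInfinite ν → μ <ᶜ ν → Poset.Eq.setoid poset ≺ ∣ ν ∣
    amalgam-≺ ν ν-regular μ<ν = ≼-≺-trans algebra≼ (RegularCardinal.×-≺ ν ν-regular
      (finitelySupported-≺ κ ν (IsRegularInfinite.infinite κ-regular) ν-regular
        (≼-≺-trans (proj₁ κ<μ) μ<ν))
      (finitelySupported-≺ μ ν (IsRegularInfinite.infinite μ-regular) ν-regular μ<ν))

theorem2p5 : (∀ {a} → ExcludedMiddle a) →
    ∀ {ℓ : Level} (μ κ μ′ κ′ : Cardinal ℓ) →
    IsRegularInfinite μ → IsRegularInfinite κ →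
    IsRegularInfinite μ′ → IsRegularInfinite κ′ →
    κ <ᶜ μ → κ′ <ᶜ μ′ →
    ((μ ≤ᶜ μ′ × κ ≤ᶜ κ′) ⇔
    ((P : Poset ℓ ℓ ℓ) → FN μ κ P → FN μ′ κ′ P))
    × (((P : Poset ℓ ℓ ℓ) → FN μ κ P → FN μ′ κ′ P) ⇔
    ((B : BooleanAlgebra ℓ ℓ) → FNᴮ μ κ B → FNᴮ μ′ κ′ B))
theorem2p5 em {ℓ} μ κ μ′ κ′ μ-regular κ-regular μ′-regular κ′-regular κ<μ κ′<μ′ =
  -- The cycle (1) to (2) to (3) to (1) yields both equivalences.
  mk⇔ posets (inequalities ∘ algebras) , mk⇔ algebras (posets ∘ inequalities)
  where
  open Classical em
  open Amalgam (Cardinal.Carrier κ′) (Cardinal.Carrier μ′)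

  posets : μ ≤ᶜ μ′ × κ ≤ᶜ κ′ → (P : Poset ℓ ℓ ℓ) → FN μ κ P → FN μ′ κ′ P
  posets (μ≤μ′ , κ≤κ′) = FN-mono μ≤μ′ κ≤κ′

  algebras : ((P : Poset ℓ ℓ ℓ) → FN μ κ P → FN μ′ κ′ P) →
             (B : BooleanAlgebra ℓ ℓ) → FNᴮ μ κ B → FNᴮ μ′ κ′ B
  algebras hyp B = hyp (BooleanAlgebraProperties.poset B)

  inequalities : ((B : BooleanAlgebra ℓ ℓ) → FNᴮ μ κ B → FNᴮ μ′ κ′ B) → μ ≤ᶜ μ′ × κ ≤ᶜ κ′
  inequalities hyp =
      byContradiction (λ μ≰μ′ → ¬FN-μκ (small⇒FN μ κ κ-regular poset
        (amalgam-≺ μ′ κ′ μ′-regular κ′-regular κ′<μ′ μ μ-regular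
          (RegularCardinal.cardinal-≺ μ μ-regular μ′ μ≰μ′))))
    -- The failed inequality makes the X-part small; the resulting (κ,κ)-FN is widened in its first
    -- argument to meet `hyp`.
    , byContradiction (λ κ≰κ′ → ¬FN-μκ (FN-mono (proj₁ κ<μ) (Identity.injection ∣ κ ∣) poset
        (interpolation⇒FN κ κ-regular
          (finitelySupported-≺ κ′ κ (IsRegularInfinite.infinite κ′-regular) κ-regular
            (RegularCardinal.cardinal-≺ κ κ-regular κ′ κ≰κ′)))))
    where
    ¬FN-μκ : ¬ FN μ κ poset
    ¬FN-μκ fn = amalgam-¬FN μ′ κ′ μ′-regular κ′-regular κ′<μ′ (hyp algebra fn)
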